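{- There are infinitely many integers $k \ge 1$ such that $k$-Hamming Distance cannot be reduced to $(k-1)$-Hamming Distance; that is, such that $\mathsf{D}^{\mathsf{EHD}_{k-1}}(\mathsf{EHD}_k) = O(1)$ does not hold.
   Context: $\mathsf{dist}(x,y)$ denotes Hamming distance. For an integer $k \ge 0$, the (exact) $k$-Hamming Distance problem is $\mathsf{EHD}_k = (\mathsf{EHD}_k^n)_{n\in\mathbb{N}}$, where $\mathsf{EHD}_k^n$ is the $2^n \times 2^n$ Boolean matrix with rows and columns indexed by $\{0,1\}^n$ and $\mathsf{EHD}_k^n(x,y) = 1$ if and only if $\mathsf{dist}(x,y) = k$. For a set $\mathcal{M}$ of Boolean matrices (a communication problem, i.e. a sequence of square Boolean matrices, is also regarded as the set of its matrices), the query set $\mathsf{QS}(\mathcal{M})$ is the set of all matrices obtained from matrices in $\mathcal{M}$ by the operations: arbitrary row and column permutations; taking arbitrary submatrices; duplicating arbitrary rows or columns. For $P \in \{0,1\}^{N \times N}$, a deterministic communication protocol with oracle access to $\mathcal{M}$ is a binary tree in which each inner node $v$ is associated with an $N \times N$ matrix $Q_v \in \mathsf{QS}(\mathcal{M})$ (with the same row and column index sets as $P$) and each leaf $\ell$ with a bit $b_\ell \in \{0,1\}$. An input $(x,y)$ defines a root-to-leaf path: at node $v$ the entry $Q_v(x,y)$ decides whether to go left or right; the output is the bit of the leaf reached. The protocol computes $P$ if the output is $P(x,y)$ for every $(x,y)$. Its cost is the depth of the tree, and $\mathsf{D}^{\mathcal{M}}(P)$ is the minimum cost of such a protocol computing $P$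 ($\infty$ if there is none). A problem $\mathcal{P}=(P_n)_n$ reduces to $\mathcal{Q}$ if $\mathsf{D}^{\mathcal{Q}}(\mathcal{P}) = O(1)$, i.e. there is a constant $c$ with $\mathsf{D}^{\mathcal{Q}}(P_n) \le c$ for all $n$. -}

module Defs where

open import Data.Bool.Base using (Bool; if_then_else_)
open import Data.Fin.Base using (Fin; finToFun; _<_)
open import Data.Fin.Permutation using (Permutation′; _⟨$⟩ʳ_)
open import Data.Fin.Properties using (_≟_)
open import Data.List.Base using (length; filter; allFin)
open import Data.Nat.Base using (ℕ; zero; suc; _^_; _⊔_; _≤_; _≡ᵇ_)
open import Data.Product.Base using (∃-syntax; _×_)
open import Data.Vec.Functional using (Vector; _∷_)
open import Relation.Binary.Core using (_Preserves_⟶_)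
open import Relation.Binary.PropositionalEquality using (_≡_)
open import Relation.Nullary.Decidable using (¬?)

Matrix : ℕ → ℕ → Set
Matrix m n = Vector (Vector Bool n) m

MatrixSet : Set₁
MatrixSet = ∀ {m n} → Matrix m n → Set

record Problem : Set where
  field
    size   : ℕ → ℕ
    matrix : ∀ n → Matrix (size n) (size n)

open Problem public

data ⟦_⟧ (𝒫 : Problem) : MatrixSet where
  member : ∀ n → ⟦ 𝒫 ⟧ (matrix 𝒫 n)

dist : ∀ {n} → Vector (Fin 2) n → Vector (Fin 2) n → ℕ
dist {n} x y = length (filter (λ i → ¬? (x i ≟ y i)) (allFin n))

-- The index set {0,1}ⁿ is enumerated as Fin (2 ^ n) through the library
-- bijection finToFun : Fin (2 ^ n) → (Fin n → Fin 2).
EHD : ℕ → Problem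
EHD k .size   n     = 2 ^ n
EHD k .matrix n x y = dist {n} (finToFun x) (finToFun y) ≡ᵇ k

-- Matrices are functions, so the closure must also identify pointwise equal
-- ones (resp).  A duplicated row or column is placed first; any other position
-- is reached by a permutation.
data QS (ℳ : MatrixSet) : MatrixSet where
  base         : ∀ {m n} {A : Matrix m n} → ℳ A → QS ℳ A
  resp         : ∀ {m n} {A B : Matrix m n} →
                 (∀ i j → A i j ≡ B i j) → QS ℳ A → QS ℳ B
  permuteRows  : ∀ {m n} {A : Matrix m n} (π : Permutation′ m) →
                 QS ℳ A → QS ℳ (λ i j → A (π ⟨$⟩ʳ i) j)
  permuteCols  : ∀ {m n} {A : Matrix m n} (π : Permutation′ n) →
                 QS ℳ A → QS ℳ (λ i j → A i (π ⟨$⟩ʳ j))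
  submatrix    : ∀ {m n m′ n′} {A : Matrix m n}
                 (ρ : Fin m′ → Fin m) (γ : Fin n′ → Fin n) →
                 ρ Preserves _<_ ⟶ _<_ → γ Preserves _<_ ⟶ _<_ →
                 QS ℳ A → QS ℳ (λ i j → A (ρ i) (γ j))
  duplicateRow : ∀ {m n} {A : Matrix m n} (i : Fin m) →
                 QS ℳ A → QS ℳ (A i ∷ A)
  duplicateCol : ∀ {m n} {A : Matrix m n} (j : Fin n) →
                 QS ℳ A → QS ℳ (λ i → A i j ∷ A i)

data Protocol (ℳ : MatrixSet) (N : ℕ) : Set where
  leaf : Bool → Protocol ℳ N
  node : (Q : Matrix N N) → QS ℳ Q → (left right : Protocol ℳ N) → Protocol ℳ N

module _ {ℳ : MatrixSet} {N : ℕ} where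

  output : Protocol ℳ N → Fin N → Fin N → Bool
  output (leaf b)              x y = b
  output (node Q _ left right) x y =
    if Q x y then output right x y else output left x y

  cost : Protocol ℳ N → ℕ
  cost (leaf _)              = zero
  cost (node _ _ left right) = suc (cost left ⊔ cost right)

  Computes : Protocol ℳ N → Matrix N N → Set
  Computes Π P = ∀ x y → output Π x y ≡ P x y

-- IsD ℳ P d says D^ℳ(P) = d for finite d: d is the minimum cost of a protocol
-- computing P.  The value ∞ is the case in which no such d exists.
IsD : ∀ (ℳ : MatrixSet) {N} → Matrix N N → ℕ → Set
IsD ℳ {N} P d =
  (∃[ Π ] Computes {ℳ} {N} Π P × cost Π ≡ d) ×
  (∀ (Π : Protocol ℳ N) → Computes Π P → d ≤ cost Π)

_ReducesTo_ : Problem → Problem → Set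
𝒫 ReducesTo 𝒬 = ∃[ c ] ∀ n → ∃[ d ] IsD ⟦ 𝒬 ⟧ (matrix 𝒫 n) d × d ≤ c

InfinitelyMany : (ℕ → Set) → Set
InfinitelyMany P = ∀ m → ∃[ k ] m ≤ k × P k

{-# OPTIONS --safe #-}
module Submission where

-- Transitivity of reductions makes it enough to find, for every m, one k > m
-- such that EHD k does not reduce to EHD m.
--
-- Words over a large alphabet, encoded in one-hot form, have Hamming distance
-- twice the number of mismatches.  Given a protocol of cost c, colour a pair of
-- words by the sequence of oracle answers.  Ramsey's theorem for pairs of
-- symbols, in each coordinate, yields rows x(X) and columns y(Y), X, Y ⊆ [R],
-- which mismatch exactly on X ∪ Y and whose colour depends only on X ∪ Y.
-- Ramsey's theorem for sets of coordinates yields a set T of size k/2 all of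
-- whose subsets T ∖ i get the same colour.  As x(X), y(T ∖ i) with X ⊆ T have
-- distance k or k − 2 according to whether i ∈ X, some oracle query also
-- separates these two cases.  Hence the spheres of radius m (or their
-- complements, which is the same after replacing X by T ∖ X) shatter a set of
-- k/2 points, but the VC dimension of these spheres is bounded in terms of m.

open import Axiom.ExcludedMiddle using (ExcludedMiddle)
open import Data.Nat.Base using (_≤_; _∸_)
open import Data.Product.Base using (_×_)
open import Level using (0ℓ)
open import Relation.Nullary.Negation.Core using (¬_)
open import Defs

open import Algebra.Properties.CommutativeSemigroup using (interchange; x∙yz≈y∙xz)
open import Data.Bool.Base using (Bool; true; false; _∧_; _∨_; not; if_then_else_)
import Data.Bool.Properties as Bool
open import Data.Empty using (⊥; ⊥-elim)
open import Data.Fin.Base using (Fin; zero; suc; toℕ; combine; remQuot; _↑ˡ_; _↑ʳ_; finToFun; funToFin)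
open import Data.Fin.Permutation using (_⟨$⟩ʳ_)
open import Data.Fin.Properties as Fin using (toℕ<n; toℕ-injective; remQuot-combine; finToFun-funToFin; 2↔Bool)
open import Data.List.Base using (List; []; _∷_; length; map; take; drop; filter; tabulate; allFin)
open import Data.List.Membership.Propositional using (_∈_; _∉_)
open import Data.List.Membership.Propositional.Properties using (∈-allFin; ∈-filter⁺)
open import Data.List.Properties using (length-map; length-take; length-drop; length-tabulate)
open import Data.List.Relation.Binary.Sublist.Propositional using (_⊆_; []; _∷_; _∷ʳ_; ⊆-refl; ⊆-trans; minimum; lookup)
open import Data.List.Relation.Binary.Sublist.Propositional.Properties using (All-resp-⊆; map⁺; take-⊆; drop-⊆)
open import Data.List.Relation.Unary.All as All using (All; []; _∷_)
open import Data.List.Relation.Unary.AllPairs as AllPairs using ([]; _∷_)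
open import Data.List.Relation.Unary.Any as Any using (Any; here; there)
open import Data.List.Relation.Unary.Unique.Propositional using (Unique)
open import Data.List.Relation.Unary.Unique.Propositional.Properties using (allFin⁺; Unique[x∷xs]⇒x∉xs)
open import Data.Nat.Base using (ℕ; zero; suc; _+_; _*_; _^_; _⊔_; _<_; _≡ᵇ_; z≤n; s≤s; s≤s⁻¹)
open import Data.Nat.ListAction using (sum)
open import Data.Nat.Properties
open import Algebra.Properties.CommutativeMonoid.Sum +-0-commutativeMonoid using (sum-cong-≗; ∑-distrib-+; sum-replicate-zero) renaming (sum to ∑)
open import Data.Product.Base using (Σ-syntax; ∃-syntax; _,_; proj₁; proj₂)
open import Data.Sum.Base using (_⊎_; inj₁; inj₂)
open import Data.Unit.Base using (⊤; tt)
open import Data.Vec.Base as Vec using (Vec; []; _∷_; zipWith)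
open import Data.Vec.Functional as Functional using (Vector; _++_)
open import Data.Vec.Functional.Properties using (lookup-++ˡ; lookup-++ʳ)
open import Data.Vec.Properties using (tabulate-cong; tabulate∘lookup; lookup∘tabulate)
open import Function.Base using (_∘_; id)
open import Function.Bundles using (Inverse; Equivalence; _⇔_; mk⇔)
open import Relation.Binary.Definitions using (DecidableEquality)
open import Relation.Binary.PropositionalEquality.Core using (_≡_; _≢_; refl; sym; trans; cong; cong₂; subst)
open import Relation.Binary.PropositionalEquality.Properties using (module ≡-Reasoning)
open import Relation.Nullary.Decidable using (Dec; does; yes; no; ¬?; dec-true; dec-false; does-⇔; decidable-stable)

-- Ramsey's theorem for sublists

split-⊎ : ∀ {A : Set} {P Q : A → Set} {xs} → All (λ x → P x ⊎ Q x) xs →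
          ∃[ ys ] ∃[ zs ] ys ⊆ xs × zs ⊆ xs × All P ys × All Q zs × length ys + length zs ≡ length xs
split-⊎ [] = [] , [] , [] , [] , [] , [] , refl
split-⊎ (inj₁ p ∷ ds) with ys , zs , ys⊆ , zs⊆ , ps , qs , eq ← split-⊎ ds =
  _ ∷ ys , zs , refl ∷ ys⊆ , _ ∷ʳ zs⊆ , p ∷ ps , qs , cong suc eq
split-⊎ (inj₂ q ∷ ds) with ys , zs , ys⊆ , zs⊆ , ps , qs , eq ← split-⊎ ds =
  ys , _ ∷ zs , _ ∷ʳ ys⊆ , refl ∷ zs⊆ , ps , q ∷ qs , trans (+-suc _ _) (cong suc eq)

rest-large : ∀ {y z l m t} → y < m → y + z ≡ l → m + t < l → t < z
rest-large {y} {z} {l} {m} {t} y<m eq large = +-cancelˡ-< m t z (begin-strict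
  m + t  <⟨ large ⟩
  l      ≡⟨ eq ⟨
  y + z  ≤⟨ +-monoˡ-≤ z (<⇒≤ y<m) ⟩
  m + z  ∎)
  where open ≤-Reasoning

-- `R` is a relation because an element may fit several holes, as when sets are sorted by the points
-- they contain. If fewer than `m` elements go to the first hole, the others still exceed the bound
-- for the remaining holes.
pigeonhole : ∀ {A C : Set} {R : A → C → Set} m (cs : List C) (xs : List A) →
             All (λ x → Any (R x) cs) xs → length cs * m < length xs →
             ∃[ ys ] ys ⊆ xs × m ≤ length ys × ∃[ c ] c ∈ cs × All (λ y → R y c) ys
pigeonhole m []       (x ∷ xs) (() ∷ _) _
pigeonhole {R = R} m (c ∷ cs) xs hits large
  with ys , zs , ys⊆ , zs⊆ , here-ys , there-zs , eq ← split-⊎ (All.map Any.toSum hits)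
  with m ≤? length ys
... | yes m≤ = ys , ys⊆ , m≤ , c , here refl , here-ys
... | no m≰ with us , us⊆ , m≤ , c′ , c′∈ , hit ← pigeonhole {R = R} m cs zs there-zs (rest-large (≰⇒> m≰) eq large)
  = us , ⊆-trans us⊆ zs⊆ , m≤ , c′ , there c′∈ , hit

Homogeneous : ∀ {A : Set} {K} → ℕ → (List A → Fin K) → List A → Fin K → Set
Homogeneous r χ xs c = ∀ {zs} → zs ⊆ xs → length zs ≡ r → χ zs ≡ c

-- The colour of a sublist of length suc r depends only on its first entry,
-- which is listed together with that colour.
HeadDetermined : ∀ {A : Set} {K} → ℕ → (List A → Fin K) → List (A × Fin K) → Set
HeadDetermined r χ []             = ⊤
HeadDetermined r χ ((x , c) ∷ ps) =
  Homogeneous r (χ ∘ (x ∷_)) (map proj₁ ps) c × HeadDetermined r χ ps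

HeadDetermined-⊆ : ∀ {A : Set} {K} r (χ : List A → Fin K) {ps qs} → qs ⊆ ps →
                   HeadDetermined r χ ps → HeadDetermined r χ qs
HeadDetermined-⊆ r χ []         _       = tt
HeadDetermined-⊆ r χ (_ ∷ʳ s)   (_ , d) = HeadDetermined-⊆ r χ s d
HeadDetermined-⊆ r χ (refl ∷ s) (h , d) =
  (λ zs⊆ → h (⊆-trans zs⊆ (map⁺ proj₁ s))) , HeadDetermined-⊆ r χ s d

HeadDetermined⇒Homogeneous : ∀ {A : Set} {K} r (χ : List A → Fin K) {c} ps →
  HeadDetermined r χ ps → All (λ p → proj₂ p ≡ c) ps →
  Homogeneous (suc r) χ (map proj₁ ps) c
HeadDetermined⇒Homogeneous r χ []       _       _           []         ()
HeadDetermined⇒Homogeneous r χ (_ ∷ ps) (h , d) (_ ∷ cs)    (_ ∷ʳ s)   eq =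
  HeadDetermined⇒Homogeneous r χ ps d cs s eq
HeadDetermined⇒Homogeneous r χ (_ ∷ ps) (h , d) (refl ∷ cs) (refl ∷ s) eq =
  h s (suc-injective eq)

Ramsey : ℕ → Set₁
Ramsey r = ∀ K m → ∃[ N ] ∀ {A : Set} (χ : List A → Fin K) xs → N ≤ length xs →
  ∃[ ys ] ys ⊆ xs × length ys ≡ m × ∃[ c ] Homogeneous r χ ys c

take-exactly : ∀ {A : Set} m (xs : List A) → m ≤ length xs → length (take m xs) ≡ m
take-exactly m xs m≤ = trans (length-take m xs) (m≤n⇒m⊓n≡m m≤)

-- The greedy choice of Erdős and Rado: keep the first entry `x`, thin out the rest until
-- `χ ∘ (x ∷_)` is constant on its sublists of length `r`, and continue inside what is left.
headDetermined : ∀ {r} → Ramsey r → ∀ K L → ∃[ N ] ∀ {A : Set} (χ : List A → Fin K) xs → N ≤ length xs →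
                 ∃[ ps ] map proj₁ ps ⊆ xs × length ps ≡ L × HeadDetermined r χ ps
headDetermined ram K zero    = zero , λ χ xs _ → [] , minimum xs , refl , tt
headDetermined {r} ram K (suc L) with M , rec ← headDetermined ram K L with N , hom ← ram K M =
  suc N , go
  where
  go : ∀ {A : Set} (χ : List A → Fin K) xs → suc N ≤ length xs →
       ∃[ ps ] map proj₁ ps ⊆ xs × length ps ≡ suc L × HeadDetermined r χ ps
  go χ (x ∷ xs) (s≤s N≤)
    with ys , ys⊆ , refl , c , h ← hom (χ ∘ (x ∷_)) xs N≤
    with ps , ps⊆ , refl , d ← rec χ ys ≤-refl =
    (x , c) ∷ ps , refl ∷ ⊆-trans ps⊆ ys⊆ , refl , (λ zs⊆ → h (⊆-trans zs⊆ ps⊆)) , d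

abstract
  ramsey : ∀ r → Ramsey r
  ramsey zero K m = m , λ χ xs m≤ →
    take m xs , take-⊆ m xs , take-exactly m xs m≤ , χ [] , λ { {[]} _ _ → refl }
  -- Among `suc (K * m)` entries with recorded colours in `Fin K`, some `m` share their colour.
  ramsey (suc r) K m with N , det ← headDetermined (ramsey r) K (suc (K * m)) = N , go
    where
    go : ∀ {A : Set} (χ : List A → Fin K) xs → N ≤ length xs →
         ∃[ ys ] ys ⊆ xs × length ys ≡ m × ∃[ c ] Homogeneous (suc r) χ ys c
    go χ xs N≤
      with ps , ps⊆ , len , d ← det χ xs N≤
      with qs , qs⊆ , m≤ , c , _ , cs ← pigeonhole {R = λ p c → proj₂ p ≡ c} m (allFin K) ps
             (All.universal (λ p → ∈-allFin (proj₂ p)) ps)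
             (≤-reflexive (trans (cong (λ l → suc (l * m)) (length-tabulate {n = K} (λ i → i))) (sym len)))
      = map proj₁ (take m qs)
      , ⊆-trans (map⁺ proj₁ qs′⊆) ps⊆
      , trans (length-map proj₁ (take m qs)) (take-exactly m qs m≤)
      , c
      , HeadDetermined⇒Homogeneous r χ (take m qs) (HeadDetermined-⊆ r χ qs′⊆ d)
          (All-resp-⊆ (take-⊆ m qs) cs)
      where
      qs′⊆ : take m qs ⊆ ps
      qs′⊆ = ⊆-trans (take-⊆ m qs) qs⊆

Unique-⊆ : ∀ {A : Set} {xs ys : List A} → xs ⊆ ys → Unique ys → Unique xs
Unique-⊆ []         _        = []
Unique-⊆ (_ ∷ʳ s)   (_ ∷ us) = Unique-⊆ s us
Unique-⊆ (refl ∷ s) (u ∷ us) = All-resp-⊆ s u ∷ Unique-⊆ s us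

-- A product Ramsey theorem for words

encodeBits : ∀ {n} → Vec Bool n → Fin (2 ^ n)
encodeBits xs = funToFin (Inverse.from 2↔Bool ∘ Vec.lookup xs)

decodeBits : ∀ {n} → Fin (2 ^ n) → Vec Bool n
decodeBits i = Vec.tabulate (Inverse.to 2↔Bool ∘ finToFun i)

decode-encode : ∀ {n} (xs : Vec Bool n) → decodeBits (encodeBits xs) ≡ xs
decode-encode xs = begin
  decodeBits (encodeBits xs)                                             ≡⟨ tabulate-cong (λ i →
    cong (Inverse.to 2↔Bool) (finToFun-funToFin (Inverse.from 2↔Bool ∘ Vec.lookup xs) i)) ⟩
  Vec.tabulate (Inverse.to 2↔Bool ∘ Inverse.from 2↔Bool ∘ Vec.lookup xs) ≡⟨ tabulate-cong (λ i →
    Inverse.strictlyInverseˡ 2↔Bool (Vec.lookup xs i)) ⟩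
  Vec.tabulate (Vec.lookup xs)                                           ≡⟨ tabulate∘lookup xs ⟩
  xs                                                                     ∎
  where open ≡-Reasoning

-- Two row symbols and two column symbols such that comparing them for
-- inequality computes the disjunction of the selecting bits.
record Gadget (B : ℕ) : Set where
  field
    row col  : Bool → ℕ
    row<     : ∀ x → row x < B
    col<     : ∀ y → col y < B
    agree    : row false ≡ col false
    disagree : ∀ x y → x ∨ y ≡ true → row x ≢ col y

open Gadget public

rowWord colWord : ∀ {B R} → Vec (Gadget B) R → Vec Bool R → Vec ℕ R
rowWord = zipWith row
colWord = zipWith col

triangleGadget : ∀ {N B} {a s b : Fin N} → N ≤ B → Unique (a ∷ s ∷ b ∷ []) → Gadget B
triangleGadget {a = a} {s} {b} N≤B distinct = record
  { row      = λ x → toℕ (if x then a else s)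
  ; col      = λ y → toℕ (if y then b else s)
  ; row<     = λ x → <-≤-trans (toℕ<n (if x then a else s)) N≤B
  ; col<     = λ y → <-≤-trans (toℕ<n (if y then b else s)) N≤B
  ; agree    = refl
  ; disagree = λ { true  true  _ → All.head (All.tail (AllPairs.head distinct)) ∘ toℕ-injective
                 ; true  false _ → All.head (AllPairs.head distinct) ∘ toℕ-injective
                 ; false true  _ → All.head (AllPairs.head (AllPairs.tail distinct)) ∘ toℕ-injective }
  }

UnionColoured : ∀ B R K → (Vec ℕ R → Vec ℕ R → Fin K) → Set
UnionColoured B R K χ =
  Σ[ gs ∈ Vec (Gadget B) R ] Σ[ f ∈ (Vec Bool R → Fin K) ]
  (∀ X Y → χ (rowWord gs X) (colWord gs Y) ≡ f (zipWith _∨_ X Y))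

-- In every coordinate a triangle a < s < b is chosen, and a, s serve as row
-- symbols, s, b as column symbols.  The pairs (a , s), (a , b), (s , b) get the
-- same colour by Ramsey's theorem, and only (s , s) is a pair of equal symbols.
productRamsey : ∀ R K → ∃[ B₀ ] ∀ B → B₀ ≤ B → ∀ χ → UnionColoured B R K χ
productRamsey zero    K = zero , λ B _ χ → [] , (λ _ → χ [] []) , λ { [] [] → refl }
productRamsey (suc R) K
  -- A pair of head symbols is coloured by a whole function from the `2 ^ R` possible unions in the
  -- tail to `Fin K`. The 3 symbols are the triangle.
  with N , ram ← ramsey 2 (K ^ (2 ^ R)) 3
  -- A pair of tails is coloured by the table of colours of its extensions by all `N * N` pairs of
  -- head symbols.
  with B₁ , ih ← productRamsey R (K ^ (N * N)) = N ⊔ B₁ , go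
  where
  go : ∀ B → N ⊔ B₁ ≤ B → ∀ χ → UnionColoured B (suc R) K χ
  go B ≤B χ = extend (ih B (m⊔n≤o⇒n≤o N B₁ ≤B) (λ x y → funToFin (headPairColour x y)))
    where
    headPairColour : Vec ℕ R → Vec ℕ R → Fin (N * N) → Fin K
    headPairColour x y p = let (i , j) = remQuot {N} N p in χ (toℕ i ∷ x) (toℕ j ∷ y)

    extend : UnionColoured B R (K ^ (N * N)) (λ x y → funToFin (headPairColour x y)) →
             UnionColoured B (suc R) K χ
    extend (gs , tailColour , tail-eq) = choose (ram headColour (allFin N) (≤-reflexive (sym (length-tabulate {n = N} (λ i → i)))))
      where
      F : Vec Bool R → Fin N → Fin N → Fin K
      F I h h′ = finToFun (tailColour I) (combine h h′)

      F-eq : ∀ h h′ X Y → χ (toℕ h ∷ rowWord gs X) (toℕ h′ ∷ colWord gs Y) ≡ F (zipWith _∨_ X Y) h h′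
      F-eq h h′ X Y = begin
        χ (toℕ h ∷ rowWord gs X) (toℕ h′ ∷ colWord gs Y)
          ≡⟨ cong (λ (i , j) → χ (toℕ i ∷ rowWord gs X) (toℕ j ∷ colWord gs Y)) (remQuot-combine h h′) ⟨
        headPairColour (rowWord gs X) (colWord gs Y) (combine h h′)
          ≡⟨ finToFun-funToFin (headPairColour (rowWord gs X) (colWord gs Y)) (combine h h′) ⟨
        finToFun (funToFin (headPairColour (rowWord gs X) (colWord gs Y))) (combine h h′)
          ≡⟨ cong (λ k → finToFun k (combine h h′)) (tail-eq X Y) ⟩
        F (zipWith _∨_ X Y) h h′ ∎
        where open ≡-Reasoning

      pairColour : Vec Bool R → List (Fin N) → Fin K
      pairColour I (h ∷ h′ ∷ []) = F I h h′
      -- Only lists of length two matter. As `K` is arbitrary, the default is taken from the values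
      -- of `χ`.
      pairColour I _             = χ (Vec.replicate _ 0) (Vec.replicate _ 0)

      headColour : List (Fin N) → Fin (K ^ (2 ^ R))
      headColour zs = funToFin (λ i → pairColour (decodeBits i) zs)

      pairColour-eq : ∀ {zs zs′} → headColour zs ≡ headColour zs′ → ∀ I → pairColour I zs ≡ pairColour I zs′
      pairColour-eq {zs} {zs′} eq I = begin
        pairColour I zs                                ≡⟨ cong (λ J → pairColour J zs) (decode-encode I) ⟨
        pairColour (decodeBits (encodeBits I)) zs      ≡⟨ finToFun-funToFin (λ i → pairColour (decodeBits i) zs) (encodeBits I) ⟨
        finToFun (headColour zs) (encodeBits I)        ≡⟨ cong (λ k → finToFun k (encodeBits I)) eq ⟩
        finToFun (headColour zs′) (encodeBits I)       ≡⟨ finToFun-funToFin (λ i → pairColour (decodeBits i) zs′) (encodeBits I) ⟩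
        pairColour (decodeBits (encodeBits I)) zs′     ≡⟨ cong (λ J → pairColour J zs′) (decode-encode I) ⟩
        pairColour I zs′                               ∎
        where open ≡-Reasoning

      choose : ∃[ ys ] ys ⊆ allFin N × length ys ≡ 3 × ∃[ c ] Homogeneous 2 headColour ys c →
               UnionColoured B (suc R) K χ
      choose (a ∷ s ∷ b ∷ [] , ys⊆ , refl , c , hom) = g ∷ gs , f , f-eq
        where
        unique = Unique-⊆ ys⊆ (allFin⁺ N)
        g = triangleGadget (m⊔n≤o⇒m≤o N B₁ ≤B) unique

        f : Vec Bool (suc R) → Fin K
        f (x ∷ I) = if x then F I a b else F I s s

        ab = hom (refl ∷ (s ∷ʳ (refl ∷ []))) refl

        as≡ab : ∀ I → F I a s ≡ F I a b
        as≡ab = pairColour-eq {a ∷ s ∷ []} {a ∷ b ∷ []} (trans (hom (refl ∷ refl ∷ (b ∷ʳ [])) refl) (sym ab))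

        sb≡ab : ∀ I → F I s b ≡ F I a b
        sb≡ab = pairColour-eq {s ∷ b ∷ []} {a ∷ b ∷ []} (trans (hom (a ∷ʳ (refl ∷ refl ∷ [])) refl) (sym ab))

        f-eq : ∀ X Y → χ (rowWord (g ∷ gs) X) (colWord (g ∷ gs) Y) ≡ f (zipWith _∨_ X Y)
        f-eq (true  ∷ X) (true  ∷ Y) = F-eq a b X Y
        f-eq (true  ∷ X) (false ∷ Y) = trans (F-eq a s X Y) (as≡ab (zipWith _∨_ X Y))
        f-eq (false ∷ X) (true  ∷ Y) = trans (F-eq s b X Y) (sb≡ab (zipWith _∨_ X Y))
        f-eq (false ∷ X) (false ∷ Y) = F-eq s s X Y

-- The VC dimension of Hamming spheres

does⇒ : ∀ {P : Set} (P? : Dec P) → does P? ≡ true → P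
does⇒ (yes p) _ = p

Word : ℕ → Set
Word n = Vector (Fin 2) n

δ : Fin 2 → Fin 2 → ℕ
δ x y = if does (x Fin.≟ y) then 0 else 1

differences : ∀ {n} → Word n → Word n → List (Fin n)
differences {n} x y = filter (λ i → ¬? (x i Fin.≟ y i)) (allFin n)

length-filter-tabulate : ∀ {m n} (x y : Word m) (g : Fin n → Fin m) →
  length (filter (λ i → ¬? (x i Fin.≟ y i)) (tabulate g)) ≡ ∑ (λ i → δ (x (g i)) (y (g i)))
length-filter-tabulate {n = zero}  x y g = refl
length-filter-tabulate {n = suc n} x y g with x (g zero) Fin.≟ y (g zero)
... | yes _ = length-filter-tabulate x y (g ∘ suc)
... | no  _ = cong suc (length-filter-tabulate x y (g ∘ suc))

sum-filter-tabulate : ∀ {m n} (α : Fin m → ℕ) (x y : Word m) (g : Fin n → Fin m) →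
  sum (map α (filter (λ i → ¬? (x i Fin.≟ y i)) (tabulate g))) ≡ ∑ (λ i → δ (x (g i)) (y (g i)) * α (g i))
sum-filter-tabulate {n = zero}  α x y g = refl
sum-filter-tabulate {n = suc n} α x y g with x (g zero) Fin.≟ y (g zero)
... | yes _ = sum-filter-tabulate α x y (g ∘ suc)
... | no  _ = cong₂ _+_ (sym (+-identityʳ (α (g zero)))) (sum-filter-tabulate α x y (g ∘ suc))

dist-∑ : ∀ {n} (x y : Word n) → dist x y ≡ ∑ (λ i → δ (x i) (y i))
dist-∑ x y = length-filter-tabulate x y (λ i → i)

δ-parallelogram : ∀ u v w → δ u v + (δ v w * δ u w + δ v w * δ u w) ≡ δ u w + δ v w
δ-parallelogram zero       zero       zero       = refl
δ-parallelogram zero       zero       (suc zero) = refl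
δ-parallelogram zero       (suc zero) zero       = refl
δ-parallelogram zero       (suc zero) (suc zero) = refl
δ-parallelogram (suc zero) zero       zero       = refl
δ-parallelogram (suc zero) zero       (suc zero) = refl
δ-parallelogram (suc zero) (suc zero) zero       = refl
δ-parallelogram (suc zero) (suc zero) (suc zero) = refl

-- Over a binary alphabet, `u` and `v` differ exactly where one and only one of them differs from
-- `w`. The right-hand side also counts, twice, the positions where both do, and `c` is their
-- number.
dist-parallelogram : ∀ {n} (u v w : Word n) →
  let c = sum (map (λ e → δ (u e) (w e)) (differences v w)) in
  dist u v + (c + c) ≡ dist u w + dist v w
dist-parallelogram {n} u v w = begin
  dist u v + (c + c)                       ≡⟨ cong₂ (λ d c → d + (c + c)) (dist-∑ u v)
      (sum-filter-tabulate (λ e → δ (u e) (w e)) v w (λ i → i)) ⟩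
  ∑ (λ i → δ (u i) (v i)) + (∑ both + ∑ both)
    ≡⟨ cong (∑ (λ i → δ (u i) (v i)) +_) (∑-distrib-+ both both) ⟨
  ∑ (λ i → δ (u i) (v i)) + ∑ (λ i → both i + both i)
    ≡⟨ ∑-distrib-+ (λ i → δ (u i) (v i)) (λ i → both i + both i) ⟨
  ∑ (λ i → δ (u i) (v i) + (both i + both i))
    ≡⟨ sum-cong-≗ (λ i → δ-parallelogram (u i) (v i) (w i)) ⟩
  ∑ (λ i → δ (u i) (w i) + δ (v i) (w i))
    ≡⟨ ∑-distrib-+ (λ i → δ (u i) (w i)) (λ i → δ (v i) (w i)) ⟩
  ∑ (λ i → δ (u i) (w i)) + ∑ (λ i → δ (v i) (w i))
    ≡⟨ cong₂ _+_ (dist-∑ u w) (dist-∑ v w) ⟨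
  dist u w + dist v w                      ∎
  where
  open ≡-Reasoning
  c = sum (map (λ e → δ (u e) (w e)) (differences v w))
  both : Fin n → ℕ
  both i = δ (v i) (w i) * δ (u i) (w i)

module _ {P : Set} (_≟_ : DecidableEquality P) where

  delete : P → List P → List P
  delete e []       = []
  delete e (x ∷ xs) with x ≟ e
  ... | yes _ = xs
  ... | no  _ = x ∷ delete e xs

  length-delete : ∀ {e xs} → e ∈ xs → suc (length (delete e xs)) ≡ length xs
  length-delete {e} {x ∷ xs} e∈ with x ≟ e | e∈
  ... | yes _  | _         = refl
  ... | no x≢e | here refl = ⊥-elim (x≢e refl)
  ... | no _   | there e∈′ = cong suc (length-delete e∈′)

  sum-delete : ∀ (α : P → ℕ) {e xs} → e ∈ xs → α e + sum (map α (delete e xs)) ≡ sum (map α xs)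
  sum-delete α {e} {x ∷ xs} e∈ with x ≟ e | e∈
  ... | yes refl | _         = refl
  ... | no x≢e   | here refl = ⊥-elim (x≢e refl)
  ... | no _     | there e∈′ = begin
    α e + (α x + sum (map α (delete e xs))) ≡⟨ x∙yz≈y∙xz +-commutativeSemigroup (α e) (α x) _ ⟩
    α x + (α e + sum (map α (delete e xs))) ≡⟨ cong (α x +_) (sum-delete α e∈′) ⟩
    α x + sum (map α xs)                    ∎
    where
    open ≡-Reasoning

  delete-⊆ : ∀ e xs → delete e xs ⊆ xs
  delete-⊆ e []       = []
  delete-⊆ e (x ∷ xs) with x ≟ e
  ... | yes _ = x ∷ʳ ⊆-refl
  ... | no  _ = refl ∷ delete-⊆ e xs

  ∈-delete⁺ : ∀ {e x xs} → x ≢ e → x ∈ xs → x ∈ delete e xs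
  ∈-delete⁺ {e} {x} {y ∷ xs} x≢e x∈ with y ≟ e | x∈
  ... | yes refl | here refl = ⊥-elim (x≢e refl)
  ... | yes _    | there x∈′ = x∈′
  ... | no _     | here refl = here refl
  ... | no _     | there x∈′ = there (∈-delete⁺ x≢e x∈′)

  ∉-delete : ∀ e {xs} → Unique xs → e ∉ delete e xs
  ∉-delete e {x ∷ xs} (x∉ ∷ u) e∈ with x ≟ e | e∈
  ... | yes refl | e∈′       = Unique[x∷xs]⇒x∉xs (x∉ ∷ u) e∈′
  ... | no x≢e   | here refl = x≢e refl
  ... | no _     | there e∈′ = ∉-delete e u e∈′

-- A nonzero sum has a nonzero term. Its point is located in `supp` because the points of `supp`
-- become the holes of `pigeonhole`.
support-hit : ∀ {P : Set} (α : P → ℕ) {supp} → (∀ e → α e ≢ 0 → e ∈ supp) →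
              ∀ xs → sum (map α xs) ≢ 0 → Any (_∈ xs) supp
support-hit α inSupp []       ≢0 = ⊥-elim (≢0 refl)
support-hit α inSupp (x ∷ xs) ≢0 with α x in eq
... | zero  = Any.map there (support-hit α inSupp xs ≢0)
... | suc _ = Any.map (λ { refl → here refl }) (inSupp x (λ ≡0 → 1+n≢0 (trans (sym eq) ≡0)))

drop∉take : ∀ {A : Set} n {xs : List A} {x} → Unique xs → x ∈ drop n xs → x ∉ take n xs
drop∉take zero    _        x∈ ()
drop∉take (suc n) (u ∷ us) x∈ (here refl) = All.lookup u (lookup (drop-⊆ n _) x∈) refl
drop∉take (suc n) (u ∷ us) x∈ (there x∈′) = drop∉take n us x∈ x∈′

-- The weight function α plays the role of the indicator of a set of size at
-- most a, so that sum (map α (S j)) is the size of its intersection with S j.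
Shattered : ∀ {J P : Set} → ℕ → (J → List P) → List J → Set
Shattered {J} {P} a S js = ∀ (X : J → Bool) {j₀} → j₀ ∈ js → X j₀ ≡ true →
  Σ[ α ∈ (P → ℕ) ] Σ[ supp ∈ List P ] Σ[ s ∈ ℕ ]
  length supp ≤ a × (∀ e → α e ≢ 0 → e ∈ supp) × (∀ {j} → j ∈ js → sum (map α (S j)) ≡ s ⇔ X j ≡ true)

-- Two empty sets cannot be told apart, whence the 2. In the recursion, each half must exceed `a`
-- times the previous bound, so that one of `a` points is common to that many sets.
shatterBound : ℕ → ℕ → ℕ
shatterBound a zero    = 2
shatterBound a (suc b) = suc (a * shatterBound a b) + suc (a * shatterBound a b)

-- Cut js into halves and let X be one of them.  The set belonging to X meets
-- all S j in one of the halves (which one depends on whether s = 0), so one of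
-- its at most a points lies in many S j and can be removed from these.
¬Shattered : ∀ {J P : Set} → DecidableEquality J → DecidableEquality P → ∀ a b (S : J → List P) js →
             Unique js → All (λ j → length (S j) ≤ b) js → shatterBound a b ≤ length js → ¬ Shattered a S js
¬Shattered _≟J_ _ a zero S (j₁ ∷ j₂ ∷ js) ((j₁≢j₂ ∷ _) ∷ _) (S₁≤ ∷ S₂≤ ∷ _) _ shattered
  with α , supp , s , _ , _ , iff ← shattered (λ j → does (j ≟J j₁)) (here refl) (dec-true (j₁ ≟J j₁) refl)
  = j₁≢j₂ (sym (does⇒ (j₂ ≟J j₁) (Equivalence.to (iff (there (here refl)))
      (trans (trans (empty (S j₂) S₂≤) (sym (empty (S j₁) S₁≤))) (Equivalence.from (iff (here refl)) (dec-true (j₁ ≟J j₁) refl))))))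
  where
  empty : ∀ xs → length xs ≤ 0 → sum (map α xs) ≡ 0
  empty [] _ = refl
¬Shattered _ _ a zero S (_ ∷ []) _ _ (s≤s ())
¬Shattered {J} {P} _≟J_ _≟P_ a (suc b) S js unique small large shattered = contradict
  where
  open import Data.List.Membership.DecPropositional _≟J_ using (_∈?_)
  m = shatterBound a b
  h = suc (a * m)

  first second : List J
  first = take h js
  second = drop h js

  length-first : length first ≡ h
  length-first = take-exactly h js (m+n≤o⇒m≤o h large)

  h≤second : h ≤ length second
  h≤second = subst (h ≤_) (sym (length-drop h js)) (m+n≤o⇒m≤o∸n h large)

  -- The same weight serves after the removal of `e`, with target `s ∸ α e`. This is a true
  -- difference because `j₀` attains the target `s`; hence the restriction in `Shattered` to those
  -- `X` that contain some element of `js`.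
  restrict : ∀ {ys} e → ys ⊆ js → All (λ j → e ∈ S j) ys → Shattered a (λ j → delete _≟P_ e (S j)) ys
  restrict e ys⊆ e∈S X j₀∈ Xj₀ with α , supp , s , supp≤ , inSupp , iff ← shattered X (lookup ys⊆ j₀∈) Xj₀
    = α , supp , s ∸ α e , supp≤ , inSupp , λ j∈ → mk⇔
      (λ eq → Equivalence.to (iff (lookup ys⊆ j∈)) (trans (sym (sum-S j∈)) (trans (cong (α e +_) eq) (m+[n∸m]≡n αe≤s))))
      (λ Xj → +-cancelˡ-≡ (α e) _ _ (trans (sum-S j∈) (trans (Equivalence.from (iff (lookup ys⊆ j∈)) Xj) (sym (m+[n∸m]≡n αe≤s)))))
    where
    sum-S : ∀ {j} → j ∈ _ → α e + sum (map α (delete _≟P_ e (S j))) ≡ sum (map α (S j))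
    sum-S j∈ = sum-delete _≟P_ α (All.lookup e∈S j∈)
    αe≤s : α e ≤ s
    αe≤s = ≤-trans (m≤m+n (α e) _) (≤-reflexive (trans (sum-S j₀∈) (Equivalence.from (iff (lookup ys⊆ j₀∈)) Xj₀)))

  hit-half : ∀ {supp zs} → zs ⊆ js → h ≤ length zs → length supp ≤ a → ¬ All (λ j → Any (_∈ S j) supp) zs
  hit-half {supp} {zs} zs⊆ h≤ supp≤ hits
    with ys , ys⊆ , m≤ , e , _ , e∈S ← pigeonhole {R = λ j e → e ∈ S j} m supp zs hits
           (≤-trans (s≤s (*-monoˡ-≤ m supp≤)) h≤)
    = ¬Shattered _≟J_ _≟P_ a b (λ j → delete _≟P_ e (S j)) ys (Unique-⊆ (⊆-trans ys⊆ zs⊆) unique)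
        (All.zipWith (λ (e∈ , S≤) → s≤s⁻¹ (subst (_≤ suc b) (sym (length-delete _≟P_ e∈)) S≤)) (e∈S , All-resp-⊆ (⊆-trans ys⊆ zs⊆) small))
        m≤ (restrict e (⊆-trans ys⊆ zs⊆) e∈S)

  member-first : ∀ xs → length xs ≡ h → ∃[ j ] j ∈ xs
  member-first (j ∷ _) _ = j , here refl

  contradict : ⊥
  contradict with j₀ , j₀∈ ← member-first first length-first
             with shattered (λ j → does (j ∈? first)) (lookup (take-⊆ h js) j₀∈) (dec-true (j₀ ∈? first) j₀∈)
  ... | α , supp , zero , supp≤ , inSupp , iff =
    hit-half (drop-⊆ h js) h≤second supp≤ (All.tabulate (λ {j} j∈ → support-hit α inSupp (S j)
      (λ ≡0 → drop∉take h unique j∈ (does⇒ (j ∈? first) (Equivalence.to (iff (lookup (drop-⊆ h js) j∈)) ≡0)))))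
  ... | α , supp , suc s , supp≤ , inSupp , iff =
    hit-half (take-⊆ h js) (≤-reflexive (sym length-first)) supp≤ (All.tabulate (λ {j} j∈ → support-hit α inSupp (S j)
      (λ ≡0 → 1+n≢0 (trans (sym (Equivalence.from (iff (lookup (take-⊆ h js) j∈)) (dec-true (j ∈? first) j∈))) ≡0))))

-- All v j lie on the sphere around the word w of the full set, so each is given
-- by the m positions where it differs from w, and dist-parallelogram turns
-- distance m into a condition on an intersection size.
¬spheres-shatter : ∀ {J : Set} {n} → DecidableEquality J → ∀ m (u : (J → Bool) → Word n) (v : J → Word n) js →
  Unique js → shatterBound (m + m) m ≤ length js →
  ¬ (∀ X {j} → j ∈ js → dist (u X) (v j) ≡ m ⇔ X j ≡ true)
¬spheres-shatter {J} {n} _≟J_ m u v js unique large sphere =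
  ¬Shattered _≟J_ Fin._≟_ (m + m) m S js unique (All.tabulate (λ j∈ → ≤-reflexive (S-size j∈))) large shattered
  where
  w = u (λ _ → true)
  S : J → List (Fin n)
  S j = differences (v j) w

  S-size : ∀ {j} → j ∈ js → length (S j) ≡ m
  S-size j∈ = trans (dist-sym _ _) (Equivalence.from (sphere (λ _ → true) j∈) refl)
    where
    δ-sym : ∀ x y → δ x y ≡ δ y x
    δ-sym zero       zero       = refl
    δ-sym zero       (suc zero) = refl
    δ-sym (suc zero) zero       = refl
    δ-sym (suc zero) (suc zero) = refl
    dist-sym : ∀ (x y : Word n) → dist x y ≡ dist y x
    dist-sym x y = trans (dist-∑ x y) (trans (sum-cong-≗ (λ i → δ-sym (x i) (y i))) (sym (dist-∑ y x)))

  shattered : Shattered (m + m) S js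
  shattered X {j₀} j₀∈ Xj₀ = α , differences (u X) w , c j₀ , supp≤ , inSupp , λ j∈ → mk⇔
    (λ eq → Equivalence.to (sphere X j∈) (dist≡m j∈ eq)) (λ Xj → c≡c₀ j∈ (Equivalence.from (sphere X j∈) Xj))
    where
    α : Fin n → ℕ
    α e = δ (u X e) (w e)
    c : J → ℕ
    c j = sum (map α (S j))

    formula : ∀ {j} → j ∈ js → dist (u X) (v j) + (c j + c j) ≡ dist (u X) w + m
    formula {j} j∈ = trans (dist-parallelogram (u X) (v j) w) (cong (dist (u X) w +_) (S-size j∈))

    -- Distance `m` means that exactly half of the differences between `u X` and `w` lie in `S j`.
    -- This half is the same number for all such `j`, so it can be read off at `j₀`.
    on-sphere : ∀ {j} → j ∈ js → dist (u X) (v j) ≡ m → c j + c j ≡ dist (u X) w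
    on-sphere {j} j∈ eq = +-cancelˡ-≡ m _ _ (trans (cong (_+ (c j + c j)) (sym eq)) (trans (formula j∈) (+-comm _ m)))

    on-sphere₀ = on-sphere j₀∈ (Equivalence.from (sphere X j₀∈) Xj₀)

    double-injective : ∀ {x y} → x + x ≡ y + y → x ≡ y
    double-injective {zero}  {zero}  _  = refl
    double-injective {suc x} {suc y} eq =
      cong suc (double-injective (suc-injective (trans (sym (+-suc x x)) (trans (suc-injective eq) (+-suc y y)))))

    c≡c₀ : ∀ {j} → j ∈ js → dist (u X) (v j) ≡ m → c j ≡ c j₀
    c≡c₀ j∈ eq = double-injective (trans (on-sphere j∈ eq) (sym on-sphere₀))

    dist≡m : ∀ {j} → j ∈ js → c j ≡ c j₀ → dist (u X) (v j) ≡ m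
    dist≡m {j} j∈ eq = +-cancelʳ-≡ (c j + c j) _ _ (trans (formula j∈) (trans (+-comm (dist (u X) w) m)
      (cong (m +_) (trans (sym on-sphere₀) (cong (λ x → x + x) (sym eq))))))

    sum≤length : ∀ xs → sum (map α xs) ≤ length xs
    sum≤length []       = z≤n
    sum≤length (x ∷ xs) = +-mono-≤ (δ≤1 (u X x) (w x)) (sum≤length xs)
      where
      δ≤1 : ∀ x y → δ x y ≤ 1
      δ≤1 x y with does (x Fin.≟ y)
      ... | true  = z≤n
      ... | false = s≤s z≤n

    -- Twice the intersection with `S j₀` is `dist (u X) w`, and `S j₀` has only `m` elements; hence
    -- `m + m`.
    supp≤ : length (differences (u X) w) ≤ m + m
    supp≤ = subst (_≤ m + m) on-sphere₀ (+-mono-≤ c₀≤m c₀≤m)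
      where
      c₀≤m : c j₀ ≤ m
      c₀≤m = ≤-trans (sum≤length (S j₀)) (≤-reflexive (S-size j₀∈))

    inSupp : ∀ e → α e ≢ 0 → e ∈ differences (u X) w
    inSupp e αe≢0 = ∈-filter⁺ (λ i → ¬? (u X i Fin.≟ w i)) (∈-allFin e)
      (λ eq → αe≢0 (cong (if_then 0 else 1) (dec-true (u X e Fin.≟ w e) eq)))

-- One-hot encoding

indicator : Bool → ℕ
indicator b = if b then 1 else 0

∑-++ : ∀ m {n} (f : Fin (m + n) → ℕ) → ∑ f ≡ ∑ (f ∘ (_↑ˡ n)) + ∑ (f ∘ (m ↑ʳ_))
∑-++ zero    f = refl
∑-++ (suc m) f = trans (cong (f zero +_) (∑-++ m (f ∘ suc))) (sym (+-assoc (f zero) _ _))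

∑-indicator-≡ᵇ : ∀ {n s} → s < n → ∑ {n} (λ i → indicator (toℕ i ≡ᵇ s)) ≡ 1
∑-indicator-≡ᵇ {suc n} {zero}  _         = cong suc (sum-replicate-zero n)
∑-indicator-≡ᵇ {suc n} {suc s} (s≤s s<n) = ∑-indicator-≡ᵇ s<n

oneHot : ∀ B → ℕ → Word B
oneHot B s i = if toℕ i ≡ᵇ s then suc zero else zero

encode : ∀ B {R} → Vec ℕ R → Word (R * B)
encode B []      = λ ()
encode B (s ∷ x) = oneHot B s ++ encode B x

weight : ∀ {n} → Vec Bool n → ℕ
weight X = ∑ (indicator ∘ Vec.lookup X)

dist-++ : ∀ {m n} (x x′ : Word m) (y y′ : Word n) → dist (x ++ y) (x′ ++ y′) ≡ dist x x′ + dist y y′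
dist-++ {m} {n} x x′ y y′ = begin
  dist (x ++ y) (x′ ++ y′)                            ≡⟨ dist-∑ (x ++ y) (x′ ++ y′) ⟩
  ∑ (λ i → δ ((x ++ y) i) ((x′ ++ y′) i))             ≡⟨ ∑-++ m _ ⟩
  ∑ (λ i → δ ((x ++ y) (i ↑ˡ n)) ((x′ ++ y′) (i ↑ˡ n))) + ∑ (λ i → δ ((x ++ y) (m ↑ʳ i)) ((x′ ++ y′) (m ↑ʳ i)))
    ≡⟨ cong₂ _+_ (sum-cong-≗ (λ i → cong₂ δ (lookup-++ˡ x y i) (lookup-++ˡ x′ y′ i)))
                 (sum-cong-≗ (λ i → cong₂ δ (lookup-++ʳ x y i) (lookup-++ʳ x′ y′ i))) ⟩
  ∑ (λ i → δ (x i) (x′ i)) + ∑ (λ i → δ (y i) (y′ i)) ≡⟨ cong₂ _+_ (dist-∑ x x′) (dist-∑ y y′) ⟨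
  dist x x′ + dist y y′                               ∎
  where open ≡-Reasoning

dist-cong : ∀ {n} {x x′ y y′ : Word n} → (∀ i → x i ≡ x′ i) → (∀ i → y i ≡ y′ i) → dist x y ≡ dist x′ y′
dist-cong {x = x} {x′} {y} {y′} x≗ y≗ =
  trans (dist-∑ x y) (trans (sum-cong-≗ (λ i → cong₂ δ (x≗ i) (y≗ i))) (sym (dist-∑ x′ y′)))

dist-oneHot-≢ : ∀ {B s t} → s < B → t < B → s ≢ t → dist (oneHot B s) (oneHot B t) ≡ 2
dist-oneHot-≢ {B} {s} {t} s< t< s≢t = begin
  dist (oneHot B s) (oneHot B t)                                       ≡⟨ dist-∑ (oneHot B s) (oneHot B t) ⟩
  ∑ {B} (λ i → δ (oneHot B s i) (oneHot B t i))                        ≡⟨ sum-cong-≗ {B} (λ i → pointwise (toℕ i)) ⟩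
  ∑ {B} (λ i → indicator (toℕ i ≡ᵇ s) + indicator (toℕ i ≡ᵇ t))        ≡⟨ ∑-distrib-+ {B} _ _ ⟩
  ∑ {B} (λ i → indicator (toℕ i ≡ᵇ s)) + ∑ {B} (λ i → indicator (toℕ i ≡ᵇ t)) ≡⟨ cong₂ _+_ (∑-indicator-≡ᵇ s<) (∑-indicator-≡ᵇ t<) ⟩
  2 ∎
  where
  open ≡-Reasoning
  pointwise : ∀ i → δ (if i ≡ᵇ s then suc zero else zero) (if i ≡ᵇ t then suc zero else zero) ≡
                    indicator (i ≡ᵇ s) + indicator (i ≡ᵇ t)
  pointwise i with i ≡ᵇ s in eqs | i ≡ᵇ t in eqt
  ... | false | false = refl
  ... | false | true  = refl
  ... | true  | false = refl
  ... | true  | true  = ⊥-elim (s≢t (trans (sym (does⇒ (i ≟ s) eqs)) (does⇒ (i ≟ t) eqt)))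

dist-refl : ∀ {n} (x : Word n) → dist x x ≡ 0
dist-refl {n} x = trans (dist-∑ x x)
  (trans (sum-cong-≗ (λ i → cong (if_then 0 else 1) (dec-true (x i Fin.≟ x i) refl))) (sum-replicate-zero n))

dist-gadget : ∀ {B} (g : Gadget B) x y →
              dist (oneHot B (row g x)) (oneHot B (col g y)) ≡ indicator (x ∨ y) + indicator (x ∨ y)
dist-gadget {B} g x y with x ∨ y in eq
... | true  = dist-oneHot-≢ (row< g x) (col< g y) (disagree g x y eq)
dist-gadget {B} g false false | false =
  trans (cong (λ s → dist (oneHot B s) (oneHot B (col g false))) (agree g)) (dist-refl (oneHot B (col g false)))

-- Each coordinate of the union is a mismatch, and distinct one-hot blocks differ in two positions.
-- In all other coordinates the blocks coincide.
dist-encode : ∀ {B R} (gs : Vec (Gadget B) R) X Y →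
  dist (encode B (rowWord gs X)) (encode B (colWord gs Y)) ≡ weight (zipWith _∨_ X Y) + weight (zipWith _∨_ X Y)
dist-encode []       []      []      = refl
dist-encode {B} (g ∷ gs) (x ∷ X) (y ∷ Y) = begin
  dist (oneHot B (row g x) ++ encode B (rowWord gs X)) (oneHot B (col g y) ++ encode B (colWord gs Y))
    ≡⟨ dist-++ (oneHot B (row g x)) (oneHot B (col g y)) (encode B (rowWord gs X)) (encode B (colWord gs Y)) ⟩
  dist (oneHot B (row g x)) (oneHot B (col g y)) + dist (encode B (rowWord gs X)) (encode B (colWord gs Y))
    ≡⟨ cong₂ _+_ (dist-gadget g x y) (dist-encode gs X Y) ⟩
  (i + i) + (w + w)                         ≡⟨ interchange +-commutativeSemigroup i i w w ⟩
  (i + w) + (i + w)                         ∎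
  where
  open ≡-Reasoning
  i = indicator (x ∨ y)
  w = weight (zipWith _∨_ X Y)

-- Decision trees over distance queries

-- Arbitrary maps u and v account for all operations generating QS ⟦ EHD m ⟧ and
-- make the queries closed under reindexing of the inputs.
data Tree (m : ℕ) (A B : Set) : Set where
  leaf  : Bool → Tree m A B
  query : ∀ {n} (u : A → Word n) (v : B → Word n) (left right : Tree m A B) → Tree m A B

eval : ∀ {m A B} → Tree m A B → A → B → Bool
eval (leaf b)                    x y = b
eval {m} (query u v left right) x y = if dist (u x) (v y) ≡ᵇ m then eval right x y else eval left x y

depth : ∀ {m A B} → Tree m A B → ℕ
depth (leaf _)               = 0
depth (query _ _ left right) = suc (depth left ⊔ depth right)

comap : ∀ {m A B A′ B′} → (A′ → A) → (B′ → B) → Tree m A B → Tree m A′ B′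
comap f g (leaf b)               = leaf b
comap f g (query u v left right) = query (u ∘ f) (v ∘ g) (comap f g left) (comap f g right)

eval-comap : ∀ {m A B A′ B′} (f : A′ → A) (g : B′ → B) (t : Tree m A B) x y →
             eval (comap f g t) x y ≡ eval t (f x) (g y)
eval-comap f g (leaf b) x y = refl
eval-comap {m} f g (query u v left right) x y with dist (u (f x)) (v (g y)) ≡ᵇ m
... | true  = eval-comap f g right x y
... | false = eval-comap f g left x y

depth-comap : ∀ {m A B A′ B′} (f : A′ → A) (g : B′ → B) (t : Tree m A B) → depth (comap f g t) ≡ depth t
depth-comap f g (leaf b)               = refl
depth-comap f g (query u v left right) = cong suc (cong₂ _⊔_ (depth-comap f g left) (depth-comap f g right))

graft : ∀ {m A B} → Tree m A B → (left right : Tree m A B) → Tree m A B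
graft (leaf b)        left right = if b then right else left
graft (query u v l r) left right = query u v (graft l left right) (graft r left right)

eval-graft : ∀ {m A B} (t left right : Tree m A B) x y →
             eval (graft t left right) x y ≡ (if eval t x y then eval right x y else eval left x y)
eval-graft (leaf true)  left right x y = refl
eval-graft (leaf false) left right x y = refl
eval-graft {m} (query u v l r) left right x y with dist (u x) (v y) ≡ᵇ m
... | true  = eval-graft r left right x y
... | false = eval-graft l left right x y

depth-graft : ∀ {m A B d} (t left right : Tree m A B) → depth left ≤ d → depth right ≤ d →
              depth (graft t left right) ≤ depth t + d
depth-graft (leaf true)     left right _  r≤ = r≤
depth-graft (leaf false)    left right l≤ _  = l≤
depth-graft {d = d} (query u v l r) left right l≤ r≤ = s≤s (⊔-lub
  (≤-trans (depth-graft l left right l≤ r≤) (+-monoˡ-≤ d (m≤m⊔n (depth l) (depth r))))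
  (≤-trans (depth-graft r left right l≤ r≤) (+-monoˡ-≤ d (m≤n⊔m (depth l) (depth r)))))

-- Composition of reductions

TreeReducible : ℕ → ℕ → Set
TreeReducible k m = ∃[ c ] ∀ n → Σ[ t ∈ Tree m (Word n) (Word n) ]
  depth t ≤ c × (∀ x y → eval t x y ≡ (dist x y ≡ᵇ k))

TreeReducible-refl : ∀ {k} → TreeReducible k k
TreeReducible-refl {k} = 1 , λ n → query id id (leaf false) (leaf true) , s≤s z≤n , λ x y → if-true-false (dist x y ≡ᵇ k)
  where
  if-true-false : ∀ b → (if b then true else false) ≡ b
  if-true-false true  = refl
  if-true-false false = refl

-- Each query is replaced by the tree `sol n`, pulled back along `u` and `v`, and the translated
-- subtrees are grafted onto its leaves. One level thus becomes at most `c` levels.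
substitute : ∀ {k m c A B} → (∀ n → Σ[ t ∈ Tree m (Word n) (Word n) ] depth t ≤ c × (∀ x y → eval t x y ≡ (dist x y ≡ᵇ k))) →
             ∀ (t : Tree k A B) → Σ[ t′ ∈ Tree m A B ] depth t′ ≤ depth t * c × (∀ x y → eval t′ x y ≡ eval t x y)
substitute sol (leaf b) = leaf b , z≤n , λ x y → refl
substitute {k} {c = c} sol (query {n} u v left right)
  with l , l≤ , l≡ ← substitute sol left
     | r , r≤ , r≡ ← substitute sol right
     | t , t≤ , t≡ ← sol n
  = graft (comap u v t) l r
  , ≤-trans (depth-graft (comap u v t) l r (≤-trans l≤ (*-monoˡ-≤ c (m≤m⊔n (depth left) (depth right)))) (≤-trans r≤ (*-monoˡ-≤ c (m≤n⊔m (depth left) (depth right)))))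
            (+-monoˡ-≤ _ (≤-trans (≤-reflexive (depth-comap u v t)) t≤))
  , correct
  where
  correct : ∀ x y → eval (graft (comap u v t) l r) x y ≡ (if dist (u x) (v y) ≡ᵇ k then eval right x y else eval left x y)
  correct x y rewrite eval-graft (comap u v t) l r x y | eval-comap u v t x y | t≡ (u x) (v y) | l≡ x y | r≡ x y = refl

TreeReducible-trans : ∀ {k l m} → TreeReducible k l → TreeReducible l m → TreeReducible k m
TreeReducible-trans (c , sol) (c′ , sol′) = c * c′ , λ n →
  let t , t≤ , t≡ = sol n
      t′ , t′≤ , t′≡ = substitute sol′ t
  in t′ , ≤-trans t′≤ (*-monoˡ-≤ c′ t≤) , λ x y → trans (t′≡ x y) (t≡ x y)

-- Translation of protocols into trees

QS-EHD : ∀ {m M N} {Q : Matrix M N} → QS ⟦ EHD m ⟧ Q →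
         Σ[ n ∈ ℕ ] Σ[ u ∈ (Fin M → Word n) ] Σ[ v ∈ (Fin N → Word n) ] (∀ i j → Q i j ≡ (dist (u i) (v j) ≡ᵇ m))
QS-EHD (base (member n)) = n , finToFun , finToFun , λ i j → refl
QS-EHD (resp A≗B qs) with n , u , v , eq ← QS-EHD qs = n , u , v , λ i j → trans (sym (A≗B i j)) (eq i j)
QS-EHD (permuteRows π qs) with n , u , v , eq ← QS-EHD qs = n , u ∘ (π ⟨$⟩ʳ_) , v , λ i j → eq (π ⟨$⟩ʳ i) j
QS-EHD (permuteCols π qs) with n , u , v , eq ← QS-EHD qs = n , u , v ∘ (π ⟨$⟩ʳ_) , λ i j → eq i (π ⟨$⟩ʳ j)
QS-EHD (submatrix ρ γ _ _ qs) with n , u , v , eq ← QS-EHD qs = n , u ∘ ρ , v ∘ γ , λ i j → eq (ρ i) (γ j)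
QS-EHD (duplicateRow r qs) with n , u , v , eq ← QS-EHD qs =
  n , u r Functional.∷ u , v , λ { zero j → eq r j ; (suc i) j → eq i j }
QS-EHD (duplicateCol c qs) with n , u , v , eq ← QS-EHD qs =
  n , u , v c Functional.∷ v , λ { i zero → eq i c ; i (suc j) → eq i j }

toTree : ∀ {m N} (Π : Protocol ⟦ EHD m ⟧ N) →
         Σ[ t ∈ Tree m (Fin N) (Fin N) ] depth t ≡ cost Π × (∀ x y → eval t x y ≡ output Π x y)
toTree (leaf b) = leaf b , refl , λ x y → refl
toTree (node Q qs left right)
  with l , l≡ , l≗ ← toTree left
     | r , r≡ , r≗ ← toTree right
     | n , u , v , eq ← QS-EHD qs
  = query u v l r , cong suc (cong₂ _⊔_ l≡ r≡) , correct
  where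
  correct : ∀ x y → eval (query u v l r) x y ≡ (if Q x y then output right x y else output left x y)
  correct x y rewrite eq x y | l≗ x y | r≗ x y = refl

ReducesTo⇒TreeReducible : ∀ {k m} → EHD k ReducesTo EHD m → TreeReducible k m
ReducesTo⇒TreeReducible {k} (c , red) = c , go
  where
  go : ∀ n → Σ[ t ∈ Tree _ (Word n) (Word n) ] depth t ≤ c × (∀ x y → eval t x y ≡ (dist x y ≡ᵇ k))
  go n with _ , ((Π , computes , refl) , _) , cost≤c ← red n
       with t , t≡ , t≗ ← toTree Π
    = comap funToFin funToFin t
    , subst (_≤ c) (sym (trans (depth-comap funToFin funToFin t) t≡)) cost≤c
    , λ x y → trans (eval-comap funToFin funToFin t x y) (trans (t≗ _ _) (trans (computes _ _)
        (cong (_≡ᵇ k) (dist-cong (finToFun-funToFin x) (finToFun-funToFin y)))))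

-- The lower bound

bit : Bool → Fin 2
bit b = if b then suc zero else zero

bit-injective : ∀ {a b} → bit a ≡ bit b → a ≡ b
bit-injective {true}  {true}  _ = refl
bit-injective {false} {false} _ = refl

-- Sequences of answers along the path of an input are padded with zeros to the common length `d`,
-- so that `funToFin` makes each of them a colour in `Fin (2 ^ d)`.
answers : ∀ {m A B} d → Tree m A B → A → B → Fin d → Fin 2
answers {m} (suc d) (query u v left right) x y zero    = bit (dist (u x) (v y) ≡ᵇ m)
answers {m} (suc d) (query u v left right) x y (suc i) =
  if dist (u x) (v y) ≡ᵇ m then answers d right x y i else answers d left x y i
answers     _       _                      x y i       = zero

-- The separating query is asked at the node where the answer sequences diverge.
separatingQuery : ∀ {m A B} {J : Set} d (t : Tree m A B) (x : J → A) (y : J → B) (κ : J → Bool) → depth t ≤ d →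
  (∀ j j′ → κ j ≡ κ j′ → ∀ i → answers d t (x j) (y j) i ≡ answers d t (x j′) (y j′) i) →
  ∀ j₁ j₀ → κ j₁ ≡ true → κ j₀ ≡ false → eval t (x j₁) (y j₁) ≢ eval t (x j₀) (y j₀) →
  Σ[ n ∈ ℕ ] Σ[ u ∈ (A → Word n) ] Σ[ v ∈ (B → Word n) ] Σ[ b ∈ Bool ]
  (∀ j → (dist (u (x j)) (v (y j)) ≡ᵇ m) ≡ (if κ j then b else not b))
separatingQuery d (leaf b) x y κ _ _ _ _ _ _ differ = ⊥-elim (differ refl)
separatingQuery {m} {A} {B} {J} (suc d) (query {n} u v left right) x y κ (s≤s depth≤) same j₁ j₀ κ₁ κ₀ differ =
  compare (q j₁) (q j₀) refl refl
  where
  q : J → Bool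
  q j = dist (u (x j)) (v (y j)) ≡ᵇ m

  -- The current answer is the first entry of the sequence, so it is constant on both classes of
  -- `κ`.
  q-by-class : ∀ {b₁ b₀} → q j₁ ≡ b₁ → q j₀ ≡ b₀ → ∀ j → q j ≡ (if κ j then b₁ else b₀)
  q-by-class q₁ q₀ j with κ j in eq
  ... | true  = trans (bit-injective (same j j₁ (trans eq (sym κ₁)) zero)) q₁
  ... | false = trans (bit-injective (same j j₀ (trans eq (sym κ₀)) zero)) q₀

  q-constant : ∀ {b} → q j₁ ≡ b → q j₀ ≡ b → ∀ j → q j ≡ b
  q-constant q₁ q₀ j = trans (q-by-class q₁ q₀ j) (Bool.if-eta (κ j))

  branch : ∀ j {b} → q j ≡ b → eval (query u v left right) (x j) (y j) ≡ (if b then eval right (x j) (y j) else eval left (x j) (y j))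
  branch j = cong (if_then eval right (x j) (y j) else eval left (x j) (y j))

  compare : ∀ b₁ b₀ → q j₁ ≡ b₁ → q j₀ ≡ b₀ →
            Σ[ n ∈ ℕ ] Σ[ u ∈ (A → Word n) ] Σ[ v ∈ (B → Word n) ] Σ[ b ∈ Bool ]
            (∀ j → (dist (u (x j)) (v (y j)) ≡ᵇ m) ≡ (if κ j then b else not b))
  -- The current query separates the classes, and `b` is its answer on the class of `j₁`.
  compare true  false q₁ q₀ = n , u , v , true  , q-by-class q₁ q₀
  compare false true  q₁ q₀ = n , u , v , false , q-by-class q₁ q₀
  -- All inputs move to the same child. The remaining answers still depend only on the class there,
  -- and the outputs at `j₁` and `j₀` still differ.
  compare true  true  q₁ q₀ =
    separatingQuery d right x y κ (m⊔n≤o⇒n≤o (depth left) (depth right) depth≤) same-right j₁ j₀ κ₁ κ₀ differ-right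
    where
    same-right : ∀ j j′ → κ j ≡ κ j′ → ∀ i → answers d right (x j) (y j) i ≡ answers d right (x j′) (y j′) i
    same-right j j′ eq i with s ← same j j′ eq (suc i) rewrite q-constant q₁ q₀ j | q-constant q₁ q₀ j′ = s
    differ-right : eval right (x j₁) (y j₁) ≢ eval right (x j₀) (y j₀)
    differ-right eq = differ (trans (branch j₁ q₁) (trans eq (sym (branch j₀ q₀))))
  compare false false q₁ q₀ =
    separatingQuery d left x y κ (m⊔n≤o⇒m≤o (depth left) (depth right) depth≤) same-left j₁ j₀ κ₁ κ₀ differ-left
    where
    same-left : ∀ j j′ → κ j ≡ κ j′ → ∀ i → answers d left (x j) (y j) i ≡ answers d left (x j′) (y j′) i
    same-left j j′ eq i with s ← same j j′ eq (suc i) rewrite q-constant q₁ q₀ j | q-constant q₁ q₀ j′ = s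
    differ-left : eval left (x j₁) (y j₁) ≢ eval left (x j₀) (y j₀)
    differ-left eq = differ (trans (branch j₁ q₁) (trans eq (sym (branch j₀ q₀))))

-- Sets of coordinates as bit vectors

zipWith-tabulate : ∀ {n} {A B C : Set} (_•_ : A → B → C) (f : Fin n → A) (g : Fin n → B) →
                   zipWith _•_ (Vec.tabulate f) (Vec.tabulate g) ≡ Vec.tabulate (λ i → f i • g i)
zipWith-tabulate {zero}  _•_ f g = refl
zipWith-tabulate {suc n} _•_ f g = cong (f zero • g zero ∷_) (zipWith-tabulate _•_ (f ∘ suc) (g ∘ suc))

module _ {R : ℕ} where

  open import Data.List.Membership.DecPropositional (Fin._≟_ {R}) using (_∈?_)

  member? : List (Fin R) → Fin R → Bool
  member? zs i = does (i ∈? zs)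

  bits : List (Fin R) → Vec Bool R
  bits zs = Vec.tabulate (member? zs)

  weight-bits : ∀ {zs} → Unique zs → weight (bits zs) ≡ length zs
  weight-bits {zs} unique = trans (sum-cong-≗ (λ i → cong indicator (lookup∘tabulate (member? zs) i))) (go zs unique)
    where
    open ≡-Reasoning
    cons : ∀ {z zs} → z ∉ zs → ∀ i → indicator (member? (z ∷ zs) i) ≡ indicator (toℕ i ≡ᵇ toℕ z) + indicator (member? zs i)
    cons {z} {zs} z∉ i with i Fin.≟ z
    ... | yes refl = sym (cong₂ (λ a b → indicator a + indicator b) (dec-true (toℕ z ≟ toℕ z) refl) (dec-false (z ∈? zs) z∉))
    ... | no i≢z   = sym (cong (λ a → indicator a + indicator (member? zs i)) (dec-false (toℕ i ≟ toℕ z) (i≢z ∘ toℕ-injective)))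

    go : ∀ zs → Unique zs → ∑ (indicator ∘ member? zs) ≡ length zs
    go []       _        = sum-replicate-zero R
    go (z ∷ zs) (z∉ ∷ u) = begin
      ∑ (indicator ∘ member? (z ∷ zs))                                              ≡⟨ sum-cong-≗ (cons (Unique[x∷xs]⇒x∉xs (z∉ ∷ u))) ⟩
      ∑ (λ i → indicator (toℕ i ≡ᵇ toℕ z) + indicator (member? zs i))               ≡⟨ ∑-distrib-+ {R} (λ i → indicator (toℕ i ≡ᵇ toℕ z)) _ ⟩
      ∑ {R} (λ i → indicator (toℕ i ≡ᵇ toℕ z)) + ∑ (indicator ∘ member? zs)         ≡⟨ cong₂ _+_ (∑-indicator-≡ᵇ (Fin.toℕ<n z)) (go zs u) ⟩
      suc (length zs)                                                               ∎

  restrictBits : List (Fin R) → (Fin R → Bool) → Vec Bool R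
  restrictBits zs X = Vec.tabulate (λ i → member? zs i ∧ X i)

  -- The list without `i` already covers all of `zs` except `i`, so the part of `X` inside `zs` can
  -- add nothing but `i`. For a fixed column, colour and distance therefore depend on `X i` alone.
  union-delete : ∀ {zs i} X → Unique zs → i ∈ zs →
    zipWith _∨_ (restrictBits zs X) (bits (delete Fin._≟_ i zs)) ≡ (if X i then bits zs else bits (delete Fin._≟_ i zs))
  union-delete {zs} {i} X unique i∈ = trans (zipWith-tabulate _∨_ _ _) (trans (tabulate-cong pointwise) (distribute (X i)))
    where
    zs∖i = delete Fin._≟_ i zs

    distribute : ∀ b → Vec.tabulate (λ i′ → if b then member? zs i′ else member? zs∖i i′) ≡ (if b then bits zs else bits zs∖i)
    distribute true  = refl
    distribute false = refl

    absorb : ∀ a b c → (a ∧ b) ∨ a ≡ (if c then a else a)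
    absorb false _     true  = refl
    absorb false _     false = refl
    absorb true  true  true  = refl
    absorb true  true  false = refl
    absorb true  false true  = refl
    absorb true  false false = refl

    at : ∀ b → (true ∧ b) ∨ false ≡ (if b then true else false)
    at true  = refl
    at false = refl

    pointwise : ∀ i′ → (member? zs i′ ∧ X i′) ∨ member? zs∖i i′ ≡ (if X i then member? zs i′ else member? zs∖i i′)
    pointwise i′ with i′ Fin.≟ i
    ... | yes refl rewrite dec-true (i ∈? zs) i∈ | dec-false (i ∈? zs∖i) (∉-delete Fin._≟_ i unique) = at (X i)
    ... | no i′≢i  rewrite does-⇔ (mk⇔ (lookup (delete-⊆ Fin._≟_ i zs)) (∈-delete⁺ Fin._≟_ i′≢i)) (i′ ∈? zs∖i) (i′ ∈? zs) =
      absorb (member? zs i′) (X i′) (X i)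

double-≢ : ∀ r → r + r ≢ suc r + suc r
double-≢ r = <⇒≢ (+-mono-< (n<1+n r) (n<1+n r))

¬TreeReducible : ∀ m r → shatterBound (m + m) m ≤ suc r → ¬ TreeReducible (suc r + suc r) m
¬TreeReducible m r large (c , solve)
  -- `T` is to have `suc r` elements, so its subsets missing one point are its `r`-sets and all
  -- receive one colour. The colours are the `2 ^ c` padded answer sequences.
  with R , ram ← ramsey r (2 ^ c) (suc r)
  with B , prod ← productRamsey R (2 ^ c)
  with t , t≤c , t-correct ← solve (R * B)
  with gs , f , f-eq ← prod B ≤-refl (λ x y → funToFin (answers c t (encode B x) (encode B y)))
  with ram (f ∘ bits) (allFin R) (≤-reflexive (sym (length-tabulate {n = R} id)))
... | [] , _ , () , _
... | T@(i₀ ∷ _) , T⊆ , length-T , β , hom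
  -- The column of `i₀` has distance `suc r + suc r` from the row of the full set and `r + r` from
  -- that of the empty set, so `t` must answer differently.
  = contradict (separatingQuery c t x y κ t≤c same (all-true , i₀ , here refl) (all-false , i₀ , here refl) refl refl differ)
  where
  all-true all-false : Fin R → Bool
  all-true  _ = true
  all-false _ = false

  T-unique : Unique T
  T-unique = Unique-⊆ T⊆ (allFin⁺ R)

  J : Set
  J = (Fin R → Bool) × Σ[ i ∈ Fin R ] i ∈ T

  κ : J → Bool
  κ (X , i , _) = X i

  rowOf : (Fin R → Bool) → Word (R * B)
  rowOf X = encode B (rowWord gs (restrictBits T X))

  colOf : Fin R → Word (R * B)
  colOf i = encode B (colWord gs (bits (delete Fin._≟_ i T)))

  x y : J → Word (R * B)
  x (X , _)     = rowOf X
  y (_ , i , _) = colOf i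

  length-T∖ : ∀ {i} → i ∈ T → length (delete Fin._≟_ i T) ≡ r
  length-T∖ i∈ = suc-injective (trans (length-delete Fin._≟_ i∈) length-T)

  -- If `i` lies in `X`, the union is all of `T`. Otherwise it is `T` without `i`, and homogeneity
  -- gives `β` for every `i`.
  colour : ∀ ((X , i , i∈) : J) → funToFin (answers c t (rowOf X) (colOf i)) ≡ (if X i then f (bits T) else β)
  colour (X , i , i∈) = trans (f-eq _ _) (trans (cong f (union-delete X T-unique i∈)) (split (X i)))
    where
    split : ∀ b → f (if b then bits T else bits (delete Fin._≟_ i T)) ≡ (if b then f (bits T) else β)
    split true  = refl
    split false = hom (delete-⊆ Fin._≟_ i T) (length-T∖ i∈)

  same : ∀ j j′ → κ j ≡ κ j′ → ∀ a → answers c t (x j) (y j) a ≡ answers c t (x j′) (y j′) a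
  same j j′ eq a = begin
    answers c t (x j) (y j) a                              ≡⟨ finToFun-funToFin (answers c t (x j) (y j)) a ⟨
    finToFun (funToFin (answers c t (x j) (y j))) a        ≡⟨ cong (λ k → finToFun k a) (trans (colour j) (trans (cong (if_then f (bits T) else β) eq) (sym (colour j′)))) ⟩
    finToFun (funToFin (answers c t (x j′) (y j′))) a      ≡⟨ finToFun-funToFin (answers c t (x j′) (y j′)) a ⟩
    answers c t (x j′) (y j′) a                            ∎
    where open ≡-Reasoning

  dist-J : ∀ X → let U = if X i₀ then bits T else bits (delete Fin._≟_ i₀ T) in
           dist (rowOf X) (colOf i₀) ≡ weight U + weight U
  dist-J X = trans (dist-encode gs _ _) (cong (λ U → weight U + weight U) (union-delete X T-unique (here refl)))

  differ : eval t (rowOf all-true) (colOf i₀) ≢ eval t (rowOf all-false) (colOf i₀)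
  differ eq = double-≢ r (trans (sym dist-false)
      (does⇒ (dist (rowOf all-false) (colOf i₀) ≟ (suc r + suc r)) (begin
      (dist (rowOf all-false) (colOf i₀) ≡ᵇ (suc r + suc r)) ≡⟨ t-correct _ _ ⟨
      eval t (rowOf all-false) (colOf i₀)                    ≡⟨ eq ⟨
      eval t (rowOf all-true) (colOf i₀)                     ≡⟨ t-correct _ _ ⟩
      (dist (rowOf all-true) (colOf i₀) ≡ᵇ (suc r + suc r))  ≡⟨ dec-true (dist (rowOf all-true) (colOf i₀) ≟ (suc r + suc r)) dist-true ⟩
      true                                                   ∎)))
    where
    open ≡-Reasoning
    dist-true : dist (rowOf all-true) (colOf i₀) ≡ suc r + suc r
    dist-true = trans (dist-J all-true) (cong (λ w → w + w) (trans (weight-bits T-unique) length-T))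
    dist-false : dist (rowOf all-false) (colOf i₀) ≡ r + r
    dist-false = trans (dist-J all-false) (cong (λ w → w + w)
      (trans (weight-bits (Unique-⊆ (delete-⊆ Fin._≟_ i₀ T) T-unique)) (length-T∖ (here refl))))

  contradict : ¬ (Σ[ n ∈ ℕ ] Σ[ u ∈ (Word (R * B) → Word n) ] Σ[ v ∈ (Word (R * B) → Word n) ] Σ[ b ∈ Bool ]
                  (∀ j → (dist (u (x j)) (v (y j)) ≡ᵇ m) ≡ (if κ j then b else not b)))
  contradict (n , u , v , b , sep) = ¬spheres-shatter Fin._≟_ m (λ X → u (rowOf (flip X))) (λ i → v (colOf i)) T T-unique
    (≤-trans large (≤-reflexive (sym length-T)))
    (λ X {i} i∈ → mk⇔ (λ eq → trans (sym (query-value X i∈)) (dec-true (dist (u (rowOf (flip X))) (v (colOf i)) ≟ m) eq))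
                      (λ Xi → does⇒ (dist (u (rowOf (flip X))) (v (colOf i)) ≟ m) (trans (query-value X i∈) Xi)))
    where
    -- If `b` is `false`, the query answers 1 exactly when `i` is outside the set, so the row of the
    -- complement is used.
    flip : (Fin R → Bool) → Fin R → Bool
    flip X i = if b then X i else not (X i)

    unflip : ∀ b a → (if (if b then a else not a) then b else not b) ≡ a
    unflip true  true  = refl
    unflip true  false = refl
    unflip false true  = refl
    unflip false false = refl

    query-value : ∀ X {i} → i ∈ T → (dist (u (rowOf (flip X))) (v (colOf i)) ≡ᵇ m) ≡ X i
    query-value X {i} i∈ = trans (sep (flip X , i , i∈)) (unflip b (X i))

-- The reductions from `m + d` down to `m` compose. The resulting cost may grow with `d` but does
-- not depend on the length of the words.
descend : ∀ m → (∀ k → m ≤ k → EHD (suc k) ReducesTo EHD k) → ∀ d → TreeReducible (m + d) m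
descend m red zero    = subst (λ k → TreeReducible k m) (sym (+-identityʳ m)) TreeReducible-refl
descend m red (suc d) = subst (λ k → TreeReducible k m) (sym (+-suc m d))
  (TreeReducible-trans (ReducesTo⇒TreeReducible (red (m + d) (m≤m+n m d))) (descend m red d))

theorem1p2 : ExcludedMiddle 0ℓ → InfinitelyMany (λ k → 1 ≤ k × ¬ (EHD k ReducesTo EHD (k ∸ 1)))
theorem1p2 em m with em {∃[ k ] m ≤ k × 1 ≤ k × ¬ (EHD k ReducesTo EHD (k ∸ 1))}
... | yes found = found
... | no none   = ⊥-elim (¬TreeReducible m r (≤-trans (m≤n+m _ m) (n≤1+n r))
    (subst (λ k → TreeReducible k m) (sym 2r≡) (descend m red d)))
  where
  s = shatterBound (m + m) m
  -- The summand `s` meets the shattering bound, and `m` ensures that the even number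
  -- `suc r + suc r` is at least `m`, so it is reached by `descend`.
  r = m + s
  d = suc (s + suc r)
  2r≡ : suc r + suc r ≡ m + d
  2r≡ = begin
    suc (m + s) + suc r    ≡⟨ cong (_+ suc r) (+-suc m s) ⟨
    m + suc s + suc r      ≡⟨ +-assoc m (suc s) (suc r) ⟩
    m + d                  ∎
    where open ≡-Reasoning
  red : ∀ k → m ≤ k → EHD (suc k) ReducesTo EHD k
  -- A failure at `suc k` would be one of the values excluded by `none`; excluded middle turns its
  -- absence into an actual reduction.
  red k m≤k = decidable-stable em (λ ¬red → none (suc k , m≤n⇒m≤1+n m≤k , s≤s z≤n , ¬red))
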